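{- (Strong normalization for DTT.) If $G;\Gamma\vdash t:p\,A@n$, then $t\in\mathbf{SN}$, i.e. $t$ is strongly normalizing with respect to $\rightsquigarrow$ (there is no infinite reduction sequence starting from $t$).
   Context: **Syntax of DTT.** Polarities are $p\in\{+,-\}$, with $\bar{+}=-$ and $\bar{ - }=+$. Types: $A,B ::= \langle p\rangle\mid A\to_p B\mid A\wedge_p B$. Terms: $t::= x\mid \mathbf{triv}\mid (t,t')\mid \mathbf{in}_d\,t\mid \lambda x.t\mid \langle t,t'\rangle\mid \nu x.t\bullet t'$ with $d\in\{1,2\}$; $\lambda x$ binds $x$ in $t$, and $\nu x$ binds $x$ in both $t$ and $t'$. Terms are identified up to renaming of bound variables. Canonical terms: $c::=x\mid\mathbf{triv}\mid(t,t')\mid\mathbf{in}_d\,t\mid\lambda x.t\mid\langle t,t'\rangle$ (i.e. every term not of the form $\nu x.t\bullet t'$). Graphs $G$ are finite lists of edges $n\preccurlyeq_p n'$ between nodes; contexts $\Gamma$ are finite lists of declarations $x:p\,A@n$, with distinct variables. $|G|,|\Gamma|$ are the lists of nodes occurring in them. **Reachability** $G\vdash n\preccurlyeq^*_p n'$ is inductively generated by: $G,n\preccurlyeq_p n',G'\vdash n\preccurlyeq^*_p n'$; $G\vdash n\preccurlyeq^*_p n$; from $G\vdash n\preccurlyeq^*_p n'$ and $G\vdash n'\preccurlyeq^*_p n''$ infer $G\vdash n\preccurlyeq^*_p n''$; from $G\vdash n'\preccurlyeq^*_{\bar p} n$ infer $G\vdash n\preccurlyeq^*_p n'$. **Typing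 rules.** (Ax) from $G\vdash n\preccurlyeq^*_p n'$ infer $G;\Gamma,x:p\,A@n,\Gamma'\vdash x:p\,A@n'$. (Unit) $G;\Gamma\vdash\mathbf{triv}:p\,\langle p\rangle@n$. (And) from $G;\Gamma\vdash t_1:p\,A@n$ and $G;\Gamma\vdash t_2:p\,B@n$ infer $G;\Gamma\vdash(t_1,t_2):p\,(A\wedge_pB)@n$. (AndBar) from $G;\Gamma\vdash t:p\,A_d@n$ infer $G;\Gamma\vdash\mathbf{in}_d\,t:p\,(A_1\wedge_{\bar p}A_2)@n$. (Imp) if $n'\notin|G|,|\Gamma|$, from $(G,n\preccurlyeq_pn');\Gamma,x:p\,A@n'\vdash t:p\,B@n'$ infer $G;\Gamma\vdash\lambda x.t:p\,(A\to_pB)@n$. (ImpBar) from $G\vdash n\preccurlyeq^*_{\bar p}n'$, $G;\Gamma\vdash t_1:\bar p\,A@n'$ and $G;\Gamma\vdash t_2:p\,B@n'$ infer $G;\Gamma\vdash\langle t_1,t_2\rangle:p\,(A\to_{\bar p}B)@n$. (Cut) from $G;\Gamma,x:\bar p\,A@n\vdash t_1:+\,B@n'$ and $G;\Gamma,x:\bar p\,A@n\vdash t_2:-\,B@n'$ infer $G;\Gamma\vdash\nu x.t_1\bullet t_2:p\,A@n$. **Reduction** $\rightsquigarrow$ is the one-step relation obtained by applying the following rules anywhere inside a term (substitution is capture-avoiding): (RImp) $\nu z.\lambda x.t\bullet\langle t_1,t_2\rangle\rightsquigarrow\nu z.[t_1/x]t\bullet t_2$; (RImpBar) $\nu z.\langle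 t_1,t_2\rangle\bullet\lambda x.t\rightsquigarrow\nu z.t_2\bullet[t_1/x]t$; (RAnd$d$) $\nu z.(t_1,t_2)\bullet\mathbf{in}_d\,t\rightsquigarrow\nu z.t_d\bullet t$; (RAndBar$d$) $\nu z.\mathbf{in}_d\,t\bullet(t_1,t_2)\rightsquigarrow\nu z.t\bullet t_d$ (for $d=1,2$); (RRet) $\nu x.t\bullet x\rightsquigarrow t$ if $x\notin\mathrm{FV}(t)$; (RBetaL) $\nu z.(\nu x.t_1\bullet t_2)\bullet t\rightsquigarrow\nu z.[t/x]t_1\bullet[t/x]t_2$; (RBetaR) $\nu z.c\bullet(\nu x.t_1\bullet t_2)\rightsquigarrow\nu z.[c/x]t_1\bullet[c/x]t_2$ for $c$ canonical. -}

module Defs where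

open import Data.Fin using (Fin; zero; suc)
open import Data.List using (List; []; _∷_; concatMap)
open import Data.List.Membership.Propositional using (_∈_; _∉_)
open import Data.Nat using (ℕ; suc)
open import Data.Product using (∃-syntax)
open import Data.Sign.Base using (Sign; +; -; opposite)
open import Data.Vec using (Vec; []; _∷_; lookup; toList)
import Data.List as List
open import Function using (flip; _∘_)
open import Induction.InfiniteDescent using (InfiniteDescendingSequenceFrom)
open import Relation.Binary.PropositionalEquality using (_≡_)
open import Relation.Nullary using (¬_)

Polarity : Set
Polarity = Sign

infixr 7 _⇒[_]_
infixr 8 _∧[_]_

-- A ⇒[ p ] B is A →ₚ B.
data Type : Set where
  ⟨_⟩    : Polarity → Type
  _⇒[_]_ : Type → Polarity → Type → Type
  _∧[_]_ : Type → Polarity → Type → Type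

data Side : Set where
  one two : Side

pick : {X : Set} → Side → X → X → X
pick one x₁ x₂ = x₁
pick two x₁ x₂ = x₂

-- Terms up to renaming of bound variables, as well-scoped de Bruijn terms:
-- m is the number of variables in scope. In ν t₁ t₂, written νx.t₁ • t₂ on
-- paper, the bound variable has index zero in both t₁ and t₂. The
-- constructor pair is (t₁,t₂), and ⟪ t₁ , t₂ ⟫ is the angle-bracket term
-- ⟨t₁,t₂⟩.
data Term (m : ℕ) : Set where
  var   : Fin m → Term m
  triv  : Term m
  pair  : Term m → Term m → Term m
  inj   : Side → Term m → Term m
  lam   : Term (suc m) → Term m
  ⟪_,_⟫ : Term m → Term m → Term m
  ν     : Term (suc m) → Term (suc m) → Term m

private
  variable
    m k : ℕ

data Canonical {m : ℕ} : Term m → Set where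
  var   : ∀ x → Canonical (var x)
  triv  : Canonical triv
  pair  : ∀ t t′ → Canonical (pair t t′)
  inj   : ∀ d t → Canonical (inj d t)
  lam   : ∀ t → Canonical (lam t)
  ⟪_,_⟫ : ∀ t t′ → Canonical ⟪ t , t′ ⟫

Renaming : ℕ → ℕ → Set
Renaming m k = Fin m → Fin k

liftᵣ : Renaming m k → Renaming (suc m) (suc k)
liftᵣ ρ zero    = zero
liftᵣ ρ (suc x) = suc (ρ x)

rename : Renaming m k → Term m → Term k
rename ρ (var x)      = var (ρ x)
rename ρ triv         = triv
rename ρ (pair t t′)  = pair (rename ρ t) (rename ρ t′)
rename ρ (inj d t)    = inj d (rename ρ t)
rename ρ (lam t)      = lam (rename (liftᵣ ρ) t)
rename ρ ⟪ t , t′ ⟫   = ⟪ rename ρ t , rename ρ t′ ⟫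
rename ρ (ν t t′)     = ν (rename (liftᵣ ρ) t) (rename (liftᵣ ρ) t′)

weaken : Term m → Term (suc m)
weaken = rename suc

Substitution : ℕ → ℕ → Set
Substitution m k = Fin m → Term k

liftₛ : Substitution m k → Substitution (suc m) (suc k)
liftₛ σ zero    = var zero
liftₛ σ (suc x) = weaken (σ x)

subst : Substitution m k → Term m → Term k
subst σ (var x)      = σ x
subst σ triv         = triv
subst σ (pair t t′)  = pair (subst σ t) (subst σ t′)
subst σ (inj d t)    = inj d (subst σ t)
subst σ (lam t)      = lam (subst (liftₛ σ) t)
subst σ ⟪ t , t′ ⟫   = ⟪ subst σ t , subst σ t′ ⟫
subst σ (ν t t′)     = ν (subst (liftₛ σ) t) (subst (liftₛ σ) t′)

-- [ s /0] t is the capture-avoiding [s/x]t, for x the variable of index zero.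
single : Term m → Substitution (suc m) m
single s zero    = s
single s (suc x) = var x

infixr 9 [_/0]_

[_/0]_ : Term m → Term (suc m) → Term m
[ s /0] t = subst (single s) t

Node : Set
Node = ℕ

infix 6 _≼[_]_

record Edge : Set where
  constructor _≼[_]_
  field
    source   : Node
    polarity : Polarity
    target   : Node

Graph : Set
Graph = List Edge

infix 6 _∙_at_

-- p ∙ A at n is the annotation p A @ n, used both for the declarations of a
-- context and for the right-hand side of a typing judgment.
record Assertion : Set where
  constructor _∙_at_
  field
    polarity : Polarity
    type     : Type
    node     : Node

-- The comma extending a graph or a context on the right is _∷_, so the most
-- recent edge or declaration is the head.
Ctx : ℕ → Set
Ctx = Vec Assertion

nodesᴳ : Graph → List Node
nodesᴳ = concatMap (λ e → Edge.source e ∷ Edge.target e ∷ [])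

nodesᶜ : Ctx m → List Node
nodesᶜ = List.map Assertion.node ∘ toList

infix 4 _⊢_≼*[_]_

data _⊢_≼*[_]_ (G : Graph) : Node → Polarity → Node → Set where
  edge  : ∀ {n p n′} → n ≼[ p ] n′ ∈ G → G ⊢ n ≼*[ p ] n′
  refl  : ∀ {n p} → G ⊢ n ≼*[ p ] n
  trans : ∀ {n p n′ n″} →
          G ⊢ n ≼*[ p ] n′ → G ⊢ n′ ≼*[ p ] n″ → G ⊢ n ≼*[ p ] n″
  dual  : ∀ {n p n′} → G ⊢ n′ ≼*[ opposite p ] n → G ⊢ n ≼*[ p ] n′

infix 4 _⨾_⊢_∶_

data _⨾_⊢_∶_ (G : Graph) {m : ℕ} (Γ : Ctx m) : Term m → Assertion → Set where
  Ax : ∀ {x p A n n′} →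
       lookup Γ x ≡ p ∙ A at n →
       G ⊢ n ≼*[ p ] n′ →
       G ⨾ Γ ⊢ var x ∶ p ∙ A at n′
  Unit : ∀ {p n} → G ⨾ Γ ⊢ triv ∶ p ∙ ⟨ p ⟩ at n
  And : ∀ {t₁ t₂ p A B n} →
        G ⨾ Γ ⊢ t₁ ∶ p ∙ A at n →
        G ⨾ Γ ⊢ t₂ ∶ p ∙ B at n →
        G ⨾ Γ ⊢ pair t₁ t₂ ∶ p ∙ A ∧[ p ] B at n
  AndBar : ∀ {d t p A₁ A₂ n} →
           G ⨾ Γ ⊢ t ∶ p ∙ pick d A₁ A₂ at n →
           G ⨾ Γ ⊢ inj d t ∶ p ∙ A₁ ∧[ opposite p ] A₂ at n
  Imp : ∀ {t p A B n n′} →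
        n′ ∉ nodesᴳ G →
        n′ ∉ nodesᶜ Γ →
        (n ≼[ p ] n′ ∷ G) ⨾ (p ∙ A at n′ ∷ Γ) ⊢ t ∶ p ∙ B at n′ →
        G ⨾ Γ ⊢ lam t ∶ p ∙ A ⇒[ p ] B at n
  ImpBar : ∀ {t₁ t₂ p A B n n′} →
           G ⊢ n ≼*[ opposite p ] n′ →
           G ⨾ Γ ⊢ t₁ ∶ opposite p ∙ A at n′ →
           G ⨾ Γ ⊢ t₂ ∶ p ∙ B at n′ →
           G ⨾ Γ ⊢ ⟪ t₁ , t₂ ⟫ ∶ p ∙ A ⇒[ opposite p ] B at n
  Cut : ∀ {t₁ t₂ p A B n n′} →
        G ⨾ (opposite p ∙ A at n ∷ Γ) ⊢ t₁ ∶ + ∙ B at n′ →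
        G ⨾ (opposite p ∙ A at n ∷ Γ) ⊢ t₂ ∶ - ∙ B at n′ →
        G ⨾ Γ ⊢ ν t₁ t₂ ∶ p ∙ A at n

infix 4 _↝_

-- In RRet the side condition x ∉ FV(t) is expressed by taking t from the
-- smaller scope and weakening it.
data _↝_ {m : ℕ} : Term m → Term m → Set where
  RImp     : ∀ {t t₁ t₂} → ν (lam t) ⟪ t₁ , t₂ ⟫ ↝ ν ([ t₁ /0] t) t₂
  RImpBar  : ∀ {t t₁ t₂} → ν ⟪ t₁ , t₂ ⟫ (lam t) ↝ ν t₂ ([ t₁ /0] t)
  RAnd     : ∀ {d t t₁ t₂} → ν (pair t₁ t₂) (inj d t) ↝ ν (pick d t₁ t₂) t
  RAndBar  : ∀ {d t t₁ t₂} → ν (inj d t) (pair t₁ t₂) ↝ ν t (pick d t₁ t₂)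
  RRet     : ∀ {t} → ν (weaken t) (var zero) ↝ t
  RBetaL   : ∀ {t t₁ t₂} → ν (ν t₁ t₂) t ↝ ν ([ t /0] t₁) ([ t /0] t₂)
  RBetaR   : ∀ {c t₁ t₂} → Canonical c →
             ν c (ν t₁ t₂) ↝ ν ([ c /0] t₁) ([ c /0] t₂)

  pair₁ : ∀ {t t′ s} → t ↝ t′ → pair t s ↝ pair t′ s
  pair₂ : ∀ {t t′ s} → t ↝ t′ → pair s t ↝ pair s t′
  inj   : ∀ {d t t′} → t ↝ t′ → inj d t ↝ inj d t′
  lam   : ∀ {t t′} → t ↝ t′ → lam t ↝ lam t′
  app₁  : ∀ {t t′ s} → t ↝ t′ → ⟪ t , s ⟫ ↝ ⟪ t′ , s ⟫
  app₂  : ∀ {t t′ s} → t ↝ t′ → ⟪ s , t ⟫ ↝ ⟪ s , t′ ⟫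
  ν₁    : ∀ {t t′ s} → t ↝ t′ → ν t s ↝ ν t′ s
  ν₂    : ∀ {t t′ s} → t ↝ t′ → ν s t ↝ ν s t′

-- The library's descending sequences for the converse of _↝_ are exactly the
-- sequences f with f 0 ≡ t and f i ↝ f (suc i) for all i.
SN : Term m → Set
SN t = ¬ (∃[ f ] InfiniteDescendingSequenceFrom (flip _↝_) f t)

{-# OPTIONS --safe #-}

-- Nodes and the graph play no role for termination, and RBetaR may be allowed
-- for non-canonical terms too, which makes reduction stable under substitution.
-- The resulting system is symmetric and non-confluent. Instead of reducibility
-- candidates obtained as fixed points, cuts t • s of strongly normalising terms
-- are handled by induction on the cut type A and, for a fixed A, by
-- lexicographic induction on t and s along "immediate subterm or reduct",
-- which is well-founded on strongly normalising terms. To survive RBetaL and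
-- RBetaR, the inner induction is stated for closures t[σ] • s[τ]: σ replaces
-- variables of t of sign - and type A by terms that are safe to cut against
-- every closure of a term below t, and τ does the same with sign +. Contracting
-- (νx.t₁ • t₂)[σ] • s[τ] extends σ by x ↦ s[τ], and that this is safe is the
-- induction hypothesis, since only terms below νx.t₁ • t₂ are concerned.
-- Principal redexes produce cuts on smaller types.
module Submission where

open import Defs
open import Data.Nat using (ℕ; suc)
open import Data.Fin using (Fin; zero; suc)
open import Data.Product using (∃; ∃-syntax; _×_; _,_; proj₁; proj₂)
open import Data.Sign.Base using (+; -; opposite)
open import Data.Sum using (_⊎_; inj₁; inj₂)
open import Data.Vec using (lookup)
open import Data.Vec.Functional using (_∷_)
open import Function using (flip; id; _∘_)
open import Induction.InfiniteDescent
  using (InfiniteDescendingSequenceFrom; descent∧acc⇒unsatisfiable)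
open import Induction.WellFounded using (Acc; acc; acc-inverse; module Subrelation)
open import Relation.Binary.Construct.Closure.ReflexiveTransitive
  using (Star; ε; _◅_; _◅◅_; gmap)
open import Relation.Binary.PropositionalEquality as ≡
  using (_≡_; _≗_; refl; sym; cong; cong₂)

private
  variable
    m k l : ℕ
    t t₁ t₂ t′ s s₁ s₂ s′ : Term m

-- Substitution calculus

liftₛ-≗ : ∀ {ρ : Renaming m k} {σ : Substitution m k} →
          var ∘ ρ ≗ σ → var ∘ liftᵣ ρ ≗ liftₛ σ
liftₛ-≗ h zero    = refl
liftₛ-≗ h (suc x) = cong weaken (h x)

-- Here and below the composite is a parameter, fixed by a pointwise equation. Such an equation
-- lifts under binders, so function extensionality is avoided.
rename≡subst : ∀ {ρ : Renaming m k} {σ} → var ∘ ρ ≗ σ → ∀ t → rename ρ t ≡ subst σ t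
rename≡subst h (var x)     = h x
rename≡subst h triv        = refl
rename≡subst h (pair t s)  = cong₂ pair (rename≡subst h t) (rename≡subst h s)
rename≡subst h (inj d t)   = cong (inj d) (rename≡subst h t)
rename≡subst h (lam t)     = cong lam (rename≡subst (liftₛ-≗ h) t)
rename≡subst h ⟪ t , s ⟫   = cong₂ ⟪_,_⟫ (rename≡subst h t) (rename≡subst h s)
rename≡subst h (ν t s)     =
  cong₂ ν (rename≡subst (liftₛ-≗ h) t) (rename≡subst (liftₛ-≗ h) s)

module _ where
  private
    lift-≗ : ∀ {ρ : Renaming m k} {σ : Substitution k l} {τ} →
             σ ∘ ρ ≗ τ → liftₛ σ ∘ liftᵣ ρ ≗ liftₛ τ
    lift-≗ h zero    = refl
    lift-≗ h (suc x) = cong weaken (h x)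

  subst-rename : ∀ {ρ : Renaming m k} {σ : Substitution k l} {τ} →
                 σ ∘ ρ ≗ τ → ∀ t → subst σ (rename ρ t) ≡ subst τ t
  subst-rename h (var x)    = h x
  subst-rename h triv       = refl
  subst-rename h (pair t s) = cong₂ pair (subst-rename h t) (subst-rename h s)
  subst-rename h (inj d t)  = cong (inj d) (subst-rename h t)
  subst-rename h (lam t)    = cong lam (subst-rename (lift-≗ h) t)
  subst-rename h ⟪ t , s ⟫  = cong₂ ⟪_,_⟫ (subst-rename h t) (subst-rename h s)
  subst-rename h (ν t s)    =
    cong₂ ν (subst-rename (lift-≗ h) t) (subst-rename (lift-≗ h) s)

rename-rename : ∀ (ρ : Renaming m k) (ρ′ : Renaming k l) t →
                rename ρ′ (rename ρ t) ≡ rename (ρ′ ∘ ρ) t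
rename-rename ρ ρ′ t =
  ≡.trans (rename≡subst (λ _ → refl) (rename ρ t))
    (≡.trans (subst-rename (λ _ → refl) t) (sym (rename≡subst (λ _ → refl) t)))

rename-weaken : ∀ (ρ : Renaming m k) t →
                rename (liftᵣ ρ) (weaken t) ≡ weaken (rename ρ t)
rename-weaken ρ t =
  ≡.trans (rename-rename suc (liftᵣ ρ) t) (sym (rename-rename ρ suc t))

module _ where
  private
    lift-≗ : ∀ {σ : Substitution m k} {ρ : Renaming k l} {τ} →
             rename ρ ∘ σ ≗ τ → rename (liftᵣ ρ) ∘ liftₛ σ ≗ liftₛ τ
    lift-≗ h zero    = refl
    lift-≗ {σ = σ} {ρ} h (suc x) =
      ≡.trans (rename-weaken ρ (σ x)) (cong weaken (h x))

  rename-subst : ∀ {σ : Substitution m k} {ρ : Renaming k l} {τ} →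
                 rename ρ ∘ σ ≗ τ → ∀ t → rename ρ (subst σ t) ≡ subst τ t
  rename-subst h (var x)    = h x
  rename-subst h triv       = refl
  rename-subst h (pair t s) = cong₂ pair (rename-subst h t) (rename-subst h s)
  rename-subst h (inj d t)  = cong (inj d) (rename-subst h t)
  rename-subst h (lam t)    = cong lam (rename-subst (lift-≗ h) t)
  rename-subst h ⟪ t , s ⟫  = cong₂ ⟪_,_⟫ (rename-subst h t) (rename-subst h s)
  rename-subst h (ν t s)    =
    cong₂ ν (rename-subst (lift-≗ h) t) (rename-subst (lift-≗ h) s)

subst-weaken : ∀ (σ : Substitution m k) t →
               subst (liftₛ σ) (weaken t) ≡ weaken (subst σ t)
subst-weaken σ t =
  ≡.trans (subst-rename (λ _ → refl) t) (sym (rename-subst (λ _ → refl) t))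

module _ where
  private
    lift-≗ : ∀ {σ : Substitution m k} {σ′ : Substitution k l} {τ} →
             subst σ′ ∘ σ ≗ τ → subst (liftₛ σ′) ∘ liftₛ σ ≗ liftₛ τ
    lift-≗ h zero    = refl
    lift-≗ {σ = σ} {σ′} h (suc x) =
      ≡.trans (subst-weaken σ′ (σ x)) (cong weaken (h x))

  subst-subst : ∀ {σ : Substitution m k} {σ′ : Substitution k l} {τ} →
                subst σ′ ∘ σ ≗ τ → ∀ t → subst σ′ (subst σ t) ≡ subst τ t
  subst-subst h (var x)    = h x
  subst-subst h triv       = refl
  subst-subst h (pair t s) = cong₂ pair (subst-subst h t) (subst-subst h s)
  subst-subst h (inj d t)  = cong (inj d) (subst-subst h t)
  subst-subst h (lam t)    = cong lam (subst-subst (lift-≗ h) t)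
  subst-subst h ⟪ t , s ⟫  = cong₂ ⟪_,_⟫ (subst-subst h t) (subst-subst h s)
  subst-subst h (ν t s)    =
    cong₂ ν (subst-subst (lift-≗ h) t) (subst-subst (lift-≗ h) s)

subst-var : ∀ {σ : Substitution m m} → σ ≗ var → ∀ t → subst σ t ≡ t
subst-var h (var x)    = h x
subst-var h triv       = refl
subst-var h (pair t s) = cong₂ pair (subst-var h t) (subst-var h s)
subst-var h (inj d t)  = cong (inj d) (subst-var h t)
subst-var h (lam t)    = cong lam (subst-var (λ { zero → refl ; (suc x) → cong weaken (h x) }) t)
subst-var h ⟪ t , s ⟫  = cong₂ ⟪_,_⟫ (subst-var h t) (subst-var h s)
subst-var h (ν t s)    =
  cong₂ ν (subst-var (λ { zero → refl ; (suc x) → cong weaken (h x) }) t)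
          (subst-var (λ { zero → refl ; (suc x) → cong weaken (h x) }) s)

rename-id : ∀ (t : Term m) → rename id t ≡ t
rename-id t = ≡.trans (rename≡subst (λ _ → refl) t) (subst-var (λ _ → refl) t)

single-weaken : ∀ (s t : Term m) → [ s /0] weaken t ≡ t
single-weaken s t = ≡.trans (subst-rename (λ _ → refl) t) (subst-var (λ _ → refl) t)

-- Contracting a beta redex in a closure extends its environment by one entry; this is where the
-- environments of the main induction grow.
single-liftₛ : ∀ (σ : Substitution m k) s t → [ s /0] subst (liftₛ σ) t ≡ subst (s ∷ σ) t
single-liftₛ σ s = subst-subst λ { zero → refl ; (suc x) → single-weaken s (σ x) }

subst-single : ∀ (σ : Substitution m k) s t →
               subst σ ([ s /0] t) ≡ [ subst σ s /0] subst (liftₛ σ) t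
subst-single σ s t =
  ≡.trans (subst-subst (λ { zero → refl ; (suc x) → refl }) t)
          (sym (single-liftₛ σ (subst σ s) t))

subst-pick : ∀ (σ : Substitution m k) d t₁ t₂ →
             subst σ (pick d t₁ t₂) ≡ pick d (subst σ t₁) (subst σ t₂)
subst-pick σ one t₁ t₂ = refl
subst-pick σ two t₁ t₂ = refl

-- Symmetric reduction

infix 4 _∣_↦_∣_ _∣_▷_∣_ _⇝_

-- The logical contractions are kept apart from the beta rules because only they must pass to a
-- component of the cut type. Sides are related without an enclosing `ν`, since a cut between two
-- closures has no bound variable.
data _∣_↦_∣_ {m : ℕ} : Term m → Term m → Term m → Term m → Set where
  RImp    : ∀ {t t₁ t₂} → lam t ∣ ⟪ t₁ , t₂ ⟫ ↦ [ t₁ /0] t ∣ t₂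
  RImpBar : ∀ {t t₁ t₂} → ⟪ t₁ , t₂ ⟫ ∣ lam t ↦ t₂ ∣ [ t₁ /0] t
  RAnd    : ∀ {d t t₁ t₂} → pair t₁ t₂ ∣ inj d t ↦ pick d t₁ t₂ ∣ t
  RAndBar : ∀ {d t t₁ t₂} → inj d t ∣ pair t₁ t₂ ↦ t ∣ pick d t₁ t₂

data _∣_▷_∣_ {m : ℕ} : Term m → Term m → Term m → Term m → Set where
  principal : ∀ {t s t′ s′} → t ∣ s ↦ t′ ∣ s′ → t ∣ s ▷ t′ ∣ s′
  RBetaL    : ∀ {t t₁ t₂} → ν t₁ t₂ ∣ t ▷ [ t /0] t₁ ∣ [ t /0] t₂
  RBetaR    : ∀ {t t₁ t₂} → t ∣ ν t₁ t₂ ▷ [ t /0] t₁ ∣ [ t /0] t₂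

-- With RBetaR restricted to canonical terms, substituting νy.t₁ • t₂ for x in
-- νz.x • (νy.s₁ • s₂) would destroy the redex.
data _⇝_ {m : ℕ} : Term m → Term m → Set where
  root  : ∀ {t s t′ s′} → t ∣ s ▷ t′ ∣ s′ → ν t s ⇝ ν t′ s′
  RRet  : ∀ {t} → ν (weaken t) (var zero) ⇝ t
  pair₁ : ∀ {t t′ s} → t ⇝ t′ → pair t s ⇝ pair t′ s
  pair₂ : ∀ {t t′ s} → t ⇝ t′ → pair s t ⇝ pair s t′
  inj   : ∀ {d t t′} → t ⇝ t′ → inj d t ⇝ inj d t′
  lam   : ∀ {t t′} → t ⇝ t′ → lam t ⇝ lam t′
  app₁  : ∀ {t t′ s} → t ⇝ t′ → ⟪ t , s ⟫ ⇝ ⟪ t′ , s ⟫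
  app₂  : ∀ {t t′ s} → t ⇝ t′ → ⟪ s , t ⟫ ⇝ ⟪ s , t′ ⟫
  ν₁    : ∀ {t t′ s} → t ⇝ t′ → ν t s ⇝ ν t′ s
  ν₂    : ∀ {t t′ s} → t ⇝ t′ → ν s t ⇝ ν s t′

infix 4 _⇝*_

_⇝*_ : Term m → Term m → Set
_⇝*_ = Star _⇝_

↝⊆⇝ : t ↝ t′ → t ⇝ t′
↝⊆⇝ RImp       = root (principal RImp)
↝⊆⇝ RImpBar    = root (principal RImpBar)
↝⊆⇝ RAnd       = root (principal RAnd)
↝⊆⇝ RAndBar    = root (principal RAndBar)
↝⊆⇝ RRet       = RRet
↝⊆⇝ RBetaL     = root RBetaL
↝⊆⇝ (RBetaR _) = root RBetaR
↝⊆⇝ (pair₁ r)  = pair₁ (↝⊆⇝ r)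
↝⊆⇝ (pair₂ r)  = pair₂ (↝⊆⇝ r)
↝⊆⇝ (inj r)    = inj (↝⊆⇝ r)
↝⊆⇝ (lam r)    = lam (↝⊆⇝ r)
↝⊆⇝ (app₁ r)   = app₁ (↝⊆⇝ r)
↝⊆⇝ (app₂ r)   = app₂ (↝⊆⇝ r)
↝⊆⇝ (ν₁ r)     = ν₁ (↝⊆⇝ r)
↝⊆⇝ (ν₂ r)     = ν₂ (↝⊆⇝ r)

▷-subst : ∀ (σ : Substitution m k) {t s t′ s′} → t ∣ s ▷ t′ ∣ s′ →
          subst σ t ∣ subst σ s ▷ subst σ t′ ∣ subst σ s′
▷-subst σ (principal (RImp {t} {t₁})) rewrite subst-single σ t₁ t = principal RImp
▷-subst σ (principal (RImpBar {t} {t₁})) rewrite subst-single σ t₁ t = principal RImpBar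
▷-subst σ (principal (RAnd {d} {_} {t₁} {t₂})) rewrite subst-pick σ d t₁ t₂ = principal RAnd
▷-subst σ (principal (RAndBar {d} {_} {t₁} {t₂})) rewrite subst-pick σ d t₁ t₂ =
  principal RAndBar
▷-subst σ (RBetaL {t} {t₁} {t₂}) rewrite subst-single σ t t₁ | subst-single σ t t₂ = RBetaL
▷-subst σ (RBetaR {t} {t₁} {t₂}) rewrite subst-single σ t t₁ | subst-single σ t t₂ = RBetaR

⇝-subst : ∀ (σ : Substitution m k) → t ⇝ t′ → subst σ t ⇝ subst σ t′
⇝-subst σ (root r)       = root (▷-subst (liftₛ σ) r)
⇝-subst σ (RRet {t}) rewrite subst-weaken σ t = RRet
⇝-subst σ (pair₁ r)      = pair₁ (⇝-subst σ r)
⇝-subst σ (pair₂ r)      = pair₂ (⇝-subst σ r)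
⇝-subst σ (inj r)        = inj (⇝-subst σ r)
⇝-subst σ (lam r)        = lam (⇝-subst (liftₛ σ) r)
⇝-subst σ (app₁ r)       = app₁ (⇝-subst σ r)
⇝-subst σ (app₂ r)       = app₂ (⇝-subst σ r)
⇝-subst σ (ν₁ r)         = ν₁ (⇝-subst (liftₛ σ) r)
⇝-subst σ (ν₂ r)         = ν₂ (⇝-subst (liftₛ σ) r)

⇝-rename : ∀ (ρ : Renaming m k) → t ⇝ t′ → rename ρ t ⇝ rename ρ t′
⇝-rename {t = t} {t′} ρ r
  rewrite rename≡subst {ρ = ρ} (λ _ → refl) t | rename≡subst {ρ = ρ} (λ _ → refl) t′ =
  ⇝-subst (var ∘ ρ) r

⇝*-liftₛ : ∀ {σ τ : Substitution m k} →
           (∀ x → σ x ⇝* τ x) → ∀ x → liftₛ σ x ⇝* liftₛ τ x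
⇝*-liftₛ h zero    = ε
⇝*-liftₛ h (suc x) = gmap weaken (⇝-rename suc) (h x)

subst-⇝* : ∀ {σ τ : Substitution m k} → (∀ x → σ x ⇝* τ x) → ∀ t → subst σ t ⇝* subst τ t
subst-⇝* h (var x)    = h x
subst-⇝* h triv       = ε
subst-⇝* h (pair t s) = 
  gmap (λ u → pair u _) pair₁ (subst-⇝* h t) ◅◅ gmap (λ u → pair _ u) pair₂ (subst-⇝* h s)
subst-⇝* h (inj d t)  = gmap (inj d) inj (subst-⇝* h t)
subst-⇝* h (lam t)    = gmap lam lam (subst-⇝* (⇝*-liftₛ h) t)
subst-⇝* h ⟪ t , s ⟫  = gmap ⟪_, _ ⟫ app₁ (subst-⇝* h t) ◅◅ gmap ⟪ _ ,_⟫ app₂ (subst-⇝* h s)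
subst-⇝* h (ν t s)    =
  gmap (flip ν _) ν₁ (subst-⇝* (⇝*-liftₛ h) t) ◅◅ gmap (ν _) ν₂ (subst-⇝* (⇝*-liftₛ h) s)

single-⇝ : s ⇝ s′ → ∀ t → [ s /0] t ⇝* [ s′ /0] t
single-⇝ r = subst-⇝* λ { zero → r ◅ ε ; (suc x) → ε }

-- Simple types

Signed : Set
Signed = Polarity × Type

Basis : ℕ → Set
Basis m = Fin m → Signed

private
  variable
    Γ Γ′ Δ : Basis m
    a b : Signed
    A B : Type

infix 4 _⊩_∶_

data _⊩_∶_ {m : ℕ} (Γ : Basis m) : Term m → Signed → Set where
  Ax     : ∀ {x a} → Γ x ≡ a → Γ ⊩ var x ∶ a
  Unit   : ∀ {p} → Γ ⊩ triv ∶ (p , ⟨ p ⟩)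
  And    : ∀ {t₁ t₂ p A B} → Γ ⊩ t₁ ∶ (p , A) → Γ ⊩ t₂ ∶ (p , B) →
           Γ ⊩ pair t₁ t₂ ∶ (p , A ∧[ p ] B)
  AndBar : ∀ {d t p A₁ A₂} → Γ ⊩ t ∶ (p , pick d A₁ A₂) →
           Γ ⊩ inj d t ∶ (p , A₁ ∧[ opposite p ] A₂)
  Imp    : ∀ {t p A B} → (p , A) ∷ Γ ⊩ t ∶ (p , B) → Γ ⊩ lam t ∶ (p , A ⇒[ p ] B)
  ImpBar : ∀ {t₁ t₂ p A B} → Γ ⊩ t₁ ∶ (opposite p , A) → Γ ⊩ t₂ ∶ (p , B) →
           Γ ⊩ ⟪ t₁ , t₂ ⟫ ∶ (p , A ⇒[ opposite p ] B)
  Cut    : ∀ {t₁ t₂ p A B} →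
           (opposite p , A) ∷ Γ ⊩ t₁ ∶ (+ , B) → (opposite p , A) ∷ Γ ⊩ t₂ ∶ (- , B) →
           Γ ⊩ ν t₁ t₂ ∶ (p , A)

signed : Assertion → Signed
signed (p ∙ A at _) = p , A

forget-nodes : ∀ {G} {Γ : Ctx m} {Δ : Basis m} {j} → (∀ x → Δ x ≡ signed (lookup Γ x)) →
               G ⨾ Γ ⊢ t ∶ j → Δ ⊩ t ∶ signed j
forget-nodes h (Ax {x} eq _)    = Ax (≡.trans (h x) (cong signed eq))
forget-nodes h Unit             = Unit
forget-nodes h (And d₁ d₂)      = And (forget-nodes h d₁) (forget-nodes h d₂)
forget-nodes h (AndBar d)       = AndBar (forget-nodes h d)
forget-nodes h (Imp _ _ d)      = Imp (forget-nodes (λ { zero → refl ; (suc x) → h x }) d)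
forget-nodes h (ImpBar _ d₁ d₂) = ImpBar (forget-nodes h d₁) (forget-nodes h d₂)
forget-nodes h (Cut d₁ d₂)      =
  Cut (forget-nodes (λ { zero → refl ; (suc x) → h x }) d₁)
      (forget-nodes (λ { zero → refl ; (suc x) → h x }) d₂)

infix 4 _⊆[_]_

-- A record rather than a bare function type, so that both bases and the renaming can be inferred
-- from a proof.
record _⊆[_]_ (Γ : Basis m) (ρ : Renaming m k) (Δ : Basis k) : Set where
  constructor ⊆-intro
  field
    retype : ∀ x → Δ (ρ x) ≡ Γ x

open _⊆[_]_

⊆-refl : Γ ⊆[ id ] Γ
⊆-refl = ⊆-intro λ _ → refl

⊆-trans : ∀ {ρ : Renaming m k} {ρ′ : Renaming k l} →
          Γ ⊆[ ρ ] Γ′ → Γ′ ⊆[ ρ′ ] Δ → Γ ⊆[ ρ′ ∘ ρ ] Δ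
⊆-trans {ρ = ρ} h h′ = ⊆-intro λ x → ≡.trans (retype h′ (ρ x)) (retype h x)

⊆-weaken : Γ ⊆[ suc ] (a ∷ Γ)
⊆-weaken = ⊆-intro λ _ → refl

⊆-lift : ∀ {ρ : Renaming m k} → Γ ⊆[ ρ ] Δ → (a ∷ Γ) ⊆[ liftᵣ ρ ] (a ∷ Δ)
⊆-lift h = ⊆-intro λ { zero → refl ; (suc x) → retype h x }

⊩-rename : ∀ {ρ : Renaming m k} → Γ ⊆[ ρ ] Δ → Γ ⊩ t ∶ a → Δ ⊩ rename ρ t ∶ a
⊩-rename h (Ax {x} eq)    = Ax (≡.trans (retype h x) eq)
⊩-rename h Unit           = Unit
⊩-rename h (And d₁ d₂)    = And (⊩-rename h d₁) (⊩-rename h d₂)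
⊩-rename h (AndBar d)     = AndBar (⊩-rename h d)
⊩-rename h (Imp d)        = Imp (⊩-rename (⊆-lift h) d)
⊩-rename h (ImpBar d₁ d₂) = ImpBar (⊩-rename h d₁) (⊩-rename h d₂)
⊩-rename h (Cut d₁ d₂)    = Cut (⊩-rename (⊆-lift h) d₁) (⊩-rename (⊆-lift h) d₂)

-- Strengthening: it recovers the typing of an `RRet` contractum from that of its weakening.
⊩-rename⁻ : ∀ {ρ : Renaming m k} → Γ ⊆[ ρ ] Δ → ∀ t → Δ ⊩ rename ρ t ∶ a → Γ ⊩ t ∶ a
⊩-rename⁻ h (var x)    (Ax eq)        = Ax (≡.trans (sym (retype h x)) eq)
⊩-rename⁻ h triv       Unit           = Unit
⊩-rename⁻ h (pair t s) (And d₁ d₂)    = And (⊩-rename⁻ h t d₁) (⊩-rename⁻ h s d₂)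
⊩-rename⁻ h (inj d t)  (AndBar e)     = AndBar (⊩-rename⁻ h t e)
⊩-rename⁻ h (lam t)    (Imp d)        = Imp (⊩-rename⁻ (⊆-lift h) t d)
⊩-rename⁻ h ⟪ t , s ⟫  (ImpBar d₁ d₂) = ImpBar (⊩-rename⁻ h t d₁) (⊩-rename⁻ h s d₂)
⊩-rename⁻ h (ν t s)    (Cut d₁ d₂)    =
  Cut (⊩-rename⁻ (⊆-lift h) t d₁) (⊩-rename⁻ (⊆-lift h) s d₂)

⊩-liftₛ : ∀ {σ : Substitution m k} →
          (∀ x → Δ ⊩ σ x ∶ Γ x) → ∀ x → a ∷ Δ ⊩ liftₛ σ x ∶ (a ∷ Γ) x
⊩-liftₛ h zero    = Ax refl
⊩-liftₛ h (suc x) = ⊩-rename ⊆-weaken (h x)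

⊩-subst : ∀ {σ : Substitution m k} →
          (∀ x → Δ ⊩ σ x ∶ Γ x) → Γ ⊩ t ∶ a → Δ ⊩ subst σ t ∶ a
⊩-subst h (Ax {x} refl)  = h x
⊩-subst h Unit           = Unit
⊩-subst h (And d₁ d₂)    = And (⊩-subst h d₁) (⊩-subst h d₂)
⊩-subst h (AndBar d)     = AndBar (⊩-subst h d)
⊩-subst h (Imp d)        = Imp (⊩-subst (⊩-liftₛ h) d)
⊩-subst h (ImpBar d₁ d₂) = ImpBar (⊩-subst h d₁) (⊩-subst h d₂)
⊩-subst h (Cut d₁ d₂)    = Cut (⊩-subst (⊩-liftₛ h) d₁) (⊩-subst (⊩-liftₛ h) d₂)

⊩-single : a ∷ Γ ⊩ t ∶ b → Γ ⊩ s ∶ a → Γ ⊩ [ s /0] t ∶ b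
⊩-single d e = ⊩-subst (λ { zero → e ; (suc x) → Ax refl }) d

-- The cut type is existential because contraction changes it: to a component for a logical rule, to
-- the type of the inner cut for a beta rule.
▷-preserves-⊩ : Γ ⊩ t ∶ (+ , A) → Γ ⊩ s ∶ (- , A) → t ∣ s ▷ t′ ∣ s′ →
                ∃[ B ] (Γ ⊩ t′ ∶ (+ , B)) × (Γ ⊩ s′ ∶ (- , B))
▷-preserves-⊩ (Imp d) (ImpBar e₁ e₂) (principal RImp)    = _ , ⊩-single d e₁ , e₂
▷-preserves-⊩ (ImpBar e₁ e₂) (Imp d) (principal RImpBar) = _ , e₂ , ⊩-single d e₁
▷-preserves-⊩ (And d₁ d₂) (AndBar {one} e) (principal RAnd)    = _ , d₁ , e
▷-preserves-⊩ (And d₁ d₂) (AndBar {two} e) (principal RAnd)    = _ , d₂ , e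
▷-preserves-⊩ (AndBar {one} e) (And d₁ d₂) (principal RAndBar) = _ , e , d₁
▷-preserves-⊩ (AndBar {two} e) (And d₁ d₂) (principal RAndBar) = _ , e , d₂
▷-preserves-⊩ (Cut d₁ d₂) e RBetaL = _ , ⊩-single d₁ e , ⊩-single d₂ e
▷-preserves-⊩ d (Cut e₁ e₂) RBetaR = _ , ⊩-single e₁ d , ⊩-single e₂ d

⇝-preserves-⊩ : Γ ⊩ t ∶ a → t ⇝ t′ → Γ ⊩ t′ ∶ a
⇝-preserves-⊩ (Cut d₁ d₂) (root r) with _ , e₁ , e₂ ← ▷-preserves-⊩ d₁ d₂ r = Cut e₁ e₂
-- The right side of a cut has sign `-`, while the bound variable has the sign opposite to that of
-- the whole term. Hence `RRet` is typable only at sign `+`.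
⇝-preserves-⊩ {a = + , _} (Cut d₁ (Ax refl)) RRet = ⊩-rename⁻ ⊆-weaken _ d₁
⇝-preserves-⊩ {a = - , _} (Cut d₁ (Ax ()))   RRet
⇝-preserves-⊩ (And d₁ d₂)    (pair₁ r) = And (⇝-preserves-⊩ d₁ r) d₂
⇝-preserves-⊩ (And d₁ d₂)    (pair₂ r) = And d₁ (⇝-preserves-⊩ d₂ r)
⇝-preserves-⊩ (AndBar d)     (inj r)   = AndBar (⇝-preserves-⊩ d r)
⇝-preserves-⊩ (Imp d)        (lam r)   = Imp (⇝-preserves-⊩ d r)
⇝-preserves-⊩ (ImpBar d₁ d₂) (app₁ r)  = ImpBar (⇝-preserves-⊩ d₁ r) d₂
⇝-preserves-⊩ (ImpBar d₁ d₂) (app₂ r)  = ImpBar d₁ (⇝-preserves-⊩ d₂ r)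
⇝-preserves-⊩ (Cut d₁ d₂)    (ν₁ r)    = Cut (⇝-preserves-⊩ d₁ r) d₂
⇝-preserves-⊩ (Cut d₁ d₂)    (ν₂ r)    = Cut d₁ (⇝-preserves-⊩ d₂ r)

-- Strongly normalising cuts

⇓ : Term m → Set
⇓ = Acc (flip _⇝_)

-- Termination of a cut whose bound variable may have been instantiated. `RRet` speaks about that
-- variable, so it is left out here and accounted for in `⇓-ν`.
data SNCut {m : ℕ} : Term m → Term m → Set where
  snCut : ∀ {t s} →
          (∀ {t′} → t ⇝ t′ → SNCut t′ s) →
          (∀ {s′} → s ⇝ s′ → SNCut t s′) →
          (∀ {t′ s′} → t ∣ s ▷ t′ ∣ s′ → SNCut t′ s′) →
          SNCut t s

SNCut-▷ : SNCut t s → t ∣ s ▷ t′ ∣ s′ → SNCut t′ s′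
SNCut-▷ (snCut _ _ h) = h

SNCut-⇝* : SNCut t s → t ⇝* t′ → s ⇝* s′ → SNCut t′ s′
SNCut-⇝* c             ε        ε        = c
SNCut-⇝* (snCut f _ _) (r ◅ rs) qs       = SNCut-⇝* (f r) rs qs
SNCut-⇝* (snCut _ g _) ε        (q ◅ qs) = SNCut-⇝* (g q) ε qs

⇓-weaken⁻ : ⇓ (weaken t) → ⇓ t
⇓-weaken⁻ (acc rs) = acc λ r → ⇓-weaken⁻ (rs (⇝-rename suc r))

SNCut⇒⇓ˡ : SNCut t s → ⇓ t
SNCut⇒⇓ˡ (snCut f _ _) = acc λ r → SNCut⇒⇓ˡ (f r)

⇓-pair : ⇓ t → ⇓ s → ⇓ (pair t s)
⇓-pair (acc f) (acc g) = acc λ where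
  (pair₁ r) → ⇓-pair (f r) (acc g)
  (pair₂ r) → ⇓-pair (acc f) (g r)

⇓-inj : ∀ {d} → ⇓ t → ⇓ (inj d t)
⇓-inj (acc f) = acc λ { (inj r) → ⇓-inj (f r) }

⇓-lam : ⇓ t → ⇓ (lam t)
⇓-lam (acc f) = acc λ { (lam r) → ⇓-lam (f r) }

⇓-⟪,⟫ : ⇓ t → ⇓ s → ⇓ ⟪ t , s ⟫
⇓-⟪,⟫ (acc f) (acc g) = acc λ where
  (app₁ r) → ⇓-⟪,⟫ (f r) (acc g)
  (app₂ r) → ⇓-⟪,⟫ (acc f) (g r)

⇓-ν : SNCut t s → ⇓ (ν t s)
⇓-ν c@(snCut f g h) = acc λ where
  (root r) → ⇓-ν (h r)
  -- The contractum is the left side with the bound variable dropped.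
  RRet     → ⇓-weaken⁻ (SNCut⇒⇓ˡ c)
  (ν₁ r)   → ⇓-ν (f r)
  (ν₂ r)   → ⇓-ν (g r)

⇓-pair⁻¹ : ⇓ (pair t s) → ⇓ t
⇓-pair⁻¹ (acc f) = acc λ r → ⇓-pair⁻¹ (f (pair₁ r))

⇓-pair⁻² : ⇓ (pair t s) → ⇓ s
⇓-pair⁻² (acc f) = acc λ r → ⇓-pair⁻² (f (pair₂ r))

⇓-inj⁻ : ∀ {d} → ⇓ (inj d t) → ⇓ t
⇓-inj⁻ (acc f) = acc λ r → ⇓-inj⁻ (f (inj r))

⇓-lam⁻ : ⇓ (lam t) → ⇓ t
⇓-lam⁻ (acc f) = acc λ r → ⇓-lam⁻ (f (lam r))

⇓-⟪,⟫⁻¹ : ⇓ ⟪ t , s ⟫ → ⇓ t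
⇓-⟪,⟫⁻¹ (acc f) = acc λ r → ⇓-⟪,⟫⁻¹ (f (app₁ r))

⇓-⟪,⟫⁻² : ⇓ ⟪ t , s ⟫ → ⇓ s
⇓-⟪,⟫⁻² (acc f) = acc λ r → ⇓-⟪,⟫⁻² (f (app₂ r))

-- A contraction after a step on the left can be simulated by contracting first and reducing
-- afterwards, in zero or more steps. Only `RRet` exposes a new head constructor, and then `RBetaL`
-- on `t ∣ s` already yields the cut `t₁ ∣ s`.
▷-after-⇝ˡ : (∀ {t′ s′} → t ∣ s ▷ t′ ∣ s′ → SNCut t′ s′) →
             t ⇝ t₁ → t₁ ∣ s ▷ t₂ ∣ s₂ → SNCut t₂ s₂
▷-after-⇝ˡ {s = s} {t₁ = t₁} h RRet r =
  SNCut-▷ (≡.subst (flip SNCut s) (single-weaken s t₁) (h RBetaL)) r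
▷-after-⇝ˡ h r (RBetaR {_} {u} {v}) = SNCut-⇝* (h RBetaR) (single-⇝ r u) (single-⇝ r v)
▷-after-⇝ˡ h (root r) RBetaL = SNCut-▷ (h RBetaL) (▷-subst _ r)
▷-after-⇝ˡ h (ν₁ r)   RBetaL = SNCut-⇝* (h RBetaL) (⇝-subst _ r ◅ ε) ε
▷-after-⇝ˡ h (ν₂ r)   RBetaL = SNCut-⇝* (h RBetaL) ε (⇝-subst _ r ◅ ε)
▷-after-⇝ˡ h (lam r)  (principal RImp) =
  SNCut-⇝* (h (principal RImp)) (⇝-subst _ r ◅ ε) ε
▷-after-⇝ˡ h (app₁ r) (principal (RImpBar {u})) =
  SNCut-⇝* (h (principal RImpBar)) ε (single-⇝ r u)
▷-after-⇝ˡ h (app₂ r) (principal RImpBar) =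
  SNCut-⇝* (h (principal RImpBar)) (r ◅ ε) ε
▷-after-⇝ˡ h (pair₁ r) (principal (RAnd {one})) = SNCut-⇝* (h (principal RAnd)) (r ◅ ε) ε
▷-after-⇝ˡ h (pair₁ r) (principal (RAnd {two})) = h (principal RAnd)
▷-after-⇝ˡ h (pair₂ r) (principal (RAnd {one})) = h (principal RAnd)
▷-after-⇝ˡ h (pair₂ r) (principal (RAnd {two})) = SNCut-⇝* (h (principal RAnd)) (r ◅ ε) ε
▷-after-⇝ˡ h (inj r)  (principal RAndBar) = SNCut-⇝* (h (principal RAndBar)) (r ◅ ε) ε

-- Typing rules out s = νx.s₁ • x: there RBetaR turns t • s into s₁ • t, whose
-- termination says nothing about the cut t • s₁ obtained by RRet.
▷-after-⇝ʳ : Γ ⊩ s ∶ (- , A) → (∀ {t′ s′} → t ∣ s ▷ t′ ∣ s′ → SNCut t′ s′) →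
             s ⇝ s₁ → t ∣ s₁ ▷ t₂ ∣ s₂ → SNCut t₂ s₂
▷-after-⇝ʳ (Cut _ (Ax ())) h RRet _
▷-after-⇝ʳ _ h r (RBetaL {_} {u} {v}) = SNCut-⇝* (h RBetaL) (single-⇝ r u) (single-⇝ r v)
▷-after-⇝ʳ _ h (root r) RBetaR = SNCut-▷ (h RBetaR) (▷-subst _ r)
▷-after-⇝ʳ _ h (ν₁ r)   RBetaR = SNCut-⇝* (h RBetaR) (⇝-subst _ r ◅ ε) ε
▷-after-⇝ʳ _ h (ν₂ r)   RBetaR = SNCut-⇝* (h RBetaR) ε (⇝-subst _ r ◅ ε)
▷-after-⇝ʳ _ h (lam r)  (principal RImpBar) =
  SNCut-⇝* (h (principal RImpBar)) ε (⇝-subst _ r ◅ ε)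
▷-after-⇝ʳ _ h (app₁ r) (principal (RImp {u})) =
  SNCut-⇝* (h (principal RImp)) (single-⇝ r u) ε
▷-after-⇝ʳ _ h (app₂ r) (principal RImp) =
  SNCut-⇝* (h (principal RImp)) ε (r ◅ ε)
▷-after-⇝ʳ _ h (pair₁ r) (principal (RAndBar {one})) = SNCut-⇝* (h (principal RAndBar)) ε (r ◅ ε)
▷-after-⇝ʳ _ h (pair₁ r) (principal (RAndBar {two})) = h (principal RAndBar)
▷-after-⇝ʳ _ h (pair₂ r) (principal (RAndBar {one})) = h (principal RAndBar)
▷-after-⇝ʳ _ h (pair₂ r) (principal (RAndBar {two})) = SNCut-⇝* (h (principal RAndBar)) ε (r ◅ ε)
▷-after-⇝ʳ _ h (inj r)  (principal RAnd) = SNCut-⇝* (h (principal RAnd)) ε (r ◅ ε)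

-- Induction on both accessibility proofs; the hypothesis on contracta survives a step on either
-- side by the two preceding lemmas. Termination of a cut thus reduces to that of its root
-- contracta.
SNCut-expansion : ⇓ t → ⇓ s → Γ ⊩ s ∶ (- , A) →
                  (∀ {t′ s′} → t ∣ s ▷ t′ ∣ s′ → SNCut t′ s′) → SNCut t s
SNCut-expansion (acc f) (acc g) d h = snCut
  (λ r → SNCut-expansion (f r) (acc g) d (▷-after-⇝ˡ h r))
  (λ r → SNCut-expansion (acc f) (g r) (⇝-preserves-⊩ d r) (▷-after-⇝ʳ d h r))
  h

-- Subterms and reducts

infix 4 _◁_

data _◁_ : ∃ Term → ∃ Term → Set where
  reduct : ∀ {m} {t t′ : Term m} → t ⇝ t′ → (_ , t′) ◁ (_ , t)
  pair₁  : ∀ {m} {t s : Term m} → (_ , t) ◁ (_ , pair t s)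
  pair₂  : ∀ {m} {t s : Term m} → (_ , s) ◁ (_ , pair t s)
  inj    : ∀ {m d} {t : Term m} → (_ , t) ◁ (_ , inj d t)
  lam    : ∀ {m} {t : Term (suc m)} → (_ , t) ◁ (_ , lam t)
  app₁   : ∀ {m} {t s : Term m} → (_ , t) ◁ (_ , ⟪ t , s ⟫)
  app₂   : ∀ {m} {t s : Term m} → (_ , s) ◁ (_ , ⟪ t , s ⟫)
  ν₁     : ∀ {m} {t s : Term (suc m)} → (_ , t) ◁ (_ , ν t s)
  ν₂     : ∀ {m} {t s : Term (suc m)} → (_ , s) ◁ (_ , ν t s)

Acc◁ : Term m → Set
Acc◁ t = Acc _◁_ (_ , t)

-- Structural induction on `t`: a reduct of an immediate subterm is an immediate subterm of a reduct
-- of `t`, hence accessible.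
Acc◁-reducts : ∀ (t : Term m) → (∀ {t′} → t ⇝ t′ → Acc◁ t′) → Acc◁ t
Acc◁-reducts (var x)    h = acc λ { (reduct r) → h r }
Acc◁-reducts triv       h = acc λ { (reduct r) → h r }
Acc◁-reducts (pair t s) h = acc λ where
  (reduct r) → h r
  pair₁      → Acc◁-reducts t λ r → acc-inverse (h (pair₁ r)) pair₁
  pair₂      → Acc◁-reducts s λ r → acc-inverse (h (pair₂ r)) pair₂
Acc◁-reducts (inj d t)  h = acc λ where
  (reduct r) → h r
  inj        → Acc◁-reducts t λ r → acc-inverse (h (inj r)) inj
Acc◁-reducts (lam t)    h = acc λ where
  (reduct r) → h r
  lam        → Acc◁-reducts t λ r → acc-inverse (h (lam r)) lam
Acc◁-reducts ⟪ t , s ⟫  h = acc λ where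
  (reduct r) → h r
  app₁       → Acc◁-reducts t λ r → acc-inverse (h (app₁ r)) app₁
  app₂       → Acc◁-reducts s λ r → acc-inverse (h (app₂ r)) app₂
Acc◁-reducts (ν t s)    h = acc λ where
  (reduct r) → h r
  ν₁         → Acc◁-reducts t λ r → acc-inverse (h (ν₁ r)) ν₁
  ν₂         → Acc◁-reducts s λ r → acc-inverse (h (ν₂ r)) ν₂

⇓⇒Acc◁ : ⇓ t → Acc◁ t
⇓⇒Acc◁ {t = t} (acc f) = Acc◁-reducts t λ r → ⇓⇒Acc◁ (f r)

-- The closures whose head constructor is that of the term itself. The closure is a separate index
-- in constructor form, so that contractions can be matched on.
data Image {m k : ℕ} (σ : Substitution m k) : Term m → Term k → Set where
  var   : ∀ {y z} → σ y ≡ var z → Image σ (var y) (var z)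
  triv  : Image σ triv triv
  pair  : ∀ {t s} → Image σ (pair t s) (pair (subst σ t) (subst σ s))
  inj   : ∀ {d t} → Image σ (inj d t) (inj d (subst σ t))
  lam   : ∀ {t} → Image σ (lam t) (lam (subst (liftₛ σ) t))
  ⟪_,_⟫ : ∀ t s → Image σ ⟪ t , s ⟫ ⟪ subst σ t , subst σ s ⟫
  ν     : ∀ {t s} → Image σ (ν t s) (ν (subst (liftₛ σ) t) (subst (liftₛ σ) s))

Image⇒≡ : ∀ {σ : Substitution m k} → Image σ t s → subst σ t ≡ s
Image⇒≡ (var eq)   = eq
Image⇒≡ triv       = refl
Image⇒≡ pair       = refl
Image⇒≡ inj        = refl
Image⇒≡ lam        = refl
Image⇒≡ ⟪ t , s ⟫  = refl
Image⇒≡ ν          = refl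

-- If neither head was supplied by `σ`, substitution creates no redex, and the contraction takes
-- place in the terms themselves.
▷-Image⁻ : ∀ {σ : Substitution m k} {u v u′ v′} →
           Image σ t u → Image σ s v → u ∣ v ▷ u′ ∣ v′ →
           ∃[ t′ ] ∃[ s′ ] (t ∣ s ▷ t′ ∣ s′) × u′ ≡ subst σ t′ × v′ ≡ subst σ s′
▷-Image⁻ {σ = σ} (lam {t}) ⟪ t₁ , _ ⟫ (principal RImp) =
  _ , _ , principal RImp , sym (subst-single σ t₁ t) , refl
▷-Image⁻ {σ = σ} ⟪ t₁ , _ ⟫ (lam {t}) (principal RImpBar) =
  _ , _ , principal RImpBar , refl , sym (subst-single σ t₁ t)
▷-Image⁻ {σ = σ} (pair {t₁} {t₂}) (inj {d}) (principal RAnd) =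
  _ , _ , principal RAnd , sym (subst-pick σ d t₁ t₂) , refl
▷-Image⁻ {σ = σ} (inj {d}) (pair {t₁} {t₂}) (principal RAndBar) =
  _ , _ , principal RAndBar , refl , sym (subst-pick σ d t₁ t₂)
▷-Image⁻ {s = s} {σ} (ν {t₁} {t₂}) i RBetaL with refl ← Image⇒≡ i =
  _ , _ , RBetaL , sym (subst-single σ s t₁) , sym (subst-single σ s t₂)
▷-Image⁻ {t = t} {σ = σ} i (ν {t₁} {t₂}) RBetaR with refl ← Image⇒≡ i =
  _ , _ , RBetaR , sym (subst-single σ t t₁) , sym (subst-single σ t t₂)

-- Good environments

OrientedCut : Polarity → Term m → Term m → Set
OrientedCut + t s = SNCut t s
OrientedCut - t s = SNCut s t

-- An entry of the environment has sign `opposite q`. Standing on the left of a cut it forces `q` to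
-- be `-`, which settles the orientation; `SNCutʳ` is the mirror image.
SNCutˡ : ∀ q {u v : Term k} → (+ , B) ≡ (opposite q , A) →
         (Γ ⊩ t ∶ (q , A) → OrientedCut q u v) → Γ ⊩ t ∶ (- , B) → SNCut v u
SNCutˡ - refl f = f

SNCutʳ : ∀ q {u v : Term k} → (- , B) ≡ (opposite q , A) →
         (Γ ⊩ t ∶ (q , A) → OrientedCut q u v) → Γ ⊩ t ∶ (+ , B) → SNCut u v
SNCutʳ + refl f = f

module _ (q : Polarity) (A : Type) where

  -- Good x Δ s, for x the accessibility of X: s can be cut against every closure,
  -- with a good environment, of a term of type (q , A) strictly below X. The
  -- renaming ρ lets s be moved under binders.
  Good  : ∀ {X} → Acc _◁_ X → Basis k → Term k → Set
  Entry : ∀ {X} → Acc _◁_ X → Basis k → Signed → Term k → Set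
  Env   : ∀ {X} → Acc _◁_ X → Basis m → Basis k → Substitution m k → Set

  Good {k} {X} (acc rs) Δ s = ∀ {n t} (lt : (n , t) ◁ X) →
    (∀ {l Γ} {ρ : Renaming k l} {Δ′ σ} → Δ ⊆[ ρ ] Δ′ →
       -- `Env` brings `Good` back in a negative position, but at the smaller proof `rs lt`: the
       -- definition is a structural recursion on accessibility.
       Γ ⊩ t ∶ (q , A) → Env (rs lt) Γ Δ′ σ → OrientedCut q (subst σ t) (rename ρ s))
    × Good (rs lt) Δ s

  Entry {k} x Δ a s =
    (∃[ y ] s ≡ var y) ⊎
    (a ≡ (opposite q , A) ×
     -- Stability of `⇓` under renamings becomes available only as a consequence of `⇓-subst`, so it
     -- is built into the entries.
     (∀ {l} {ρ : Renaming k l} {Δ′} → Δ ⊆[ ρ ] Δ′ → ⇓ (rename ρ s)) ×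
     Good x Δ s)

  Env x Γ Δ σ = ∀ y → Δ ⊩ σ y ∶ Γ y × Entry x Δ (Γ y) (σ y)

  Env-⊩ : ∀ {X} (x : Acc _◁_ X) {σ : Substitution m k} →
          Env x Γ Δ σ → Γ ⊩ t ∶ a → Δ ⊩ subst σ t ∶ a
  Env-⊩ x e = ⊩-subst (proj₁ ∘ e)

  Good-rename : ∀ {X} (x : Acc _◁_ X) {ρ : Renaming m k} → Γ ⊆[ ρ ] Δ →
                Good x Γ s → Good x Δ (rename ρ s)
  Good-rename {s = s} (acc rs) {ρ} h g lt =
    (λ {_ _ ρ′} h′ d e →
      ≡.subst (OrientedCut q _) (sym (rename-rename ρ ρ′ s))
        (proj₁ (g lt) (⊆-trans h h′) d e)) ,
    Good-rename (rs lt) h (proj₂ (g lt))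

  Entry-rename : ∀ {X} (x : Acc _◁_ X) {ρ : Renaming m k} → Γ ⊆[ ρ ] Δ →
                 Entry x Γ a s → Entry x Δ a (rename ρ s)
  Entry-rename x {ρ} h (inj₁ (y , refl)) = inj₁ (ρ y , refl)
  Entry-rename {s = s} x {ρ} h (inj₂ (eq , sn , g)) = inj₂
    (eq ,
     (λ {_ ρ′} h′ → ≡.subst ⇓ (sym (rename-rename ρ ρ′ s)) (sn (⊆-trans h h′))) ,
     Good-rename x h g)

  Env-rename : ∀ {X} (x : Acc _◁_ X) {σ : Substitution m k} {ρ : Renaming k l} → Γ′ ⊆[ ρ ] Δ →
               Env x Γ Γ′ σ → Env x Γ Δ (rename ρ ∘ σ)
  Env-rename x h e y = ⊩-rename h (proj₁ (e y)) , Entry-rename x h (proj₂ (e y))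

  Env-liftₛ : ∀ {X} (x : Acc _◁_ X) {σ : Substitution m k} →
              Env x Γ Δ σ → Env x (a ∷ Γ) (a ∷ Δ) (liftₛ σ)
  Env-liftₛ x e zero    = Ax refl , inj₁ (zero , refl)
  Env-liftₛ x e (suc y) = Env-rename x ⊆-weaken e y

  Env-var : ∀ {X} (x : Acc _◁_ X) {ρ : Renaming m k} → Γ ⊆[ ρ ] Δ → Env x Γ Δ (var ∘ ρ)
  Env-var x {ρ} h y = Ax (retype h y) , inj₁ (ρ y , refl)

  Env-◁ : ∀ {X Y} {rs : ∀ {Y} → Y ◁ X → Acc _◁_ Y} (lt : Y ◁ X) {σ : Substitution m k} →
          Env (acc rs) Γ Δ σ → Env (rs lt) Γ Δ σ
  Env-◁ lt e y with e y
  ... | d , inj₁ v             = d , inj₁ v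
  ... | d , inj₂ (eq , sn , g) = d , inj₂ (eq , sn , proj₂ (g lt))

  -- Only a variable can acquire a new head under `σ`, and then the new head belongs to a good
  -- entry.
  image? : ∀ {X} (x : Acc _◁_ X) {σ : Substitution m k} → Env x Γ Δ σ → Γ ⊩ t ∶ a →
           Image σ t (subst σ t) ⊎ (a ≡ (opposite q , A) × Good x Δ (subst σ t))
  image? x {σ} e (Ax {y} refl) with e y
  ... | _ , inj₁ (z , eq)     = inj₁ (≡.subst (Image σ (var y)) (sym eq) (var eq))
  ... | _ , inj₂ (eq , _ , g) = inj₂ (eq , g)
  image? x e Unit         = inj₁ triv
  image? x e (And _ _)    = inj₁ pair
  image? x e (AndBar _)   = inj₁ inj
  image? x e (Imp _)      = inj₁ lam
  image? x e (ImpBar _ _) = inj₁ ⟪ _ , _ ⟫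
  image? x e (Cut _ _)    = inj₁ ν

  ⇓-subst : ∀ (x : Acc◁ t) {σ : Substitution m k} →
            Γ ⊩ t ∶ a → Env x Γ Δ σ → ⇓ (subst σ t)
  -- Here `σ` also instantiates the variable bound by the cut, as beta contraction against another
  -- closure requires. The accessibility proof is that of `ν t s`, so contracting the sides moves to
  -- a smaller cut.
  SNCut-subst : ∀ (x : Acc◁ (ν t s)) {σ : Substitution (suc m) k} →
                Γ ⊩ t ∶ (+ , B) → Γ ⊩ s ∶ (- , B) → Env x Γ Δ σ →
                SNCut (subst σ t) (subst σ s)

  ⇓-subst x {σ} (Ax {y} refl) e with e y
  ... | _ , inj₁ (z , eq)      = ≡.subst ⇓ (sym eq) (acc λ ())
  ... | _ , inj₂ (_ , sn , _)  = ≡.subst ⇓ (rename-id (σ y)) (sn ⊆-refl)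
  ⇓-subst x Unit e = acc λ ()
  ⇓-subst (acc rs) (And d₁ d₂) e =
    ⇓-pair (⇓-subst (rs pair₁) d₁ (Env-◁ pair₁ e)) (⇓-subst (rs pair₂) d₂ (Env-◁ pair₂ e))
  ⇓-subst (acc rs) (AndBar d) e = ⇓-inj (⇓-subst (rs inj) d (Env-◁ inj e))
  ⇓-subst (acc rs) (Imp d) e =
    ⇓-lam (⇓-subst (rs lam) d (Env-liftₛ (rs lam) (Env-◁ lam e)))
  ⇓-subst (acc rs) (ImpBar d₁ d₂) e =
    ⇓-⟪,⟫ (⇓-subst (rs app₁) d₁ (Env-◁ app₁ e)) (⇓-subst (rs app₂) d₂ (Env-◁ app₂ e))
  ⇓-subst x (Cut d₁ d₂) e = ⇓-ν (SNCut-subst x d₁ d₂ (Env-liftₛ x e))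

  SNCut-subst (acc rs) {σ} d₁ d₂ e with image? (acc rs) e d₁ | image? (acc rs) e d₂
  -- The left side is a good entry and `s` lies immediately below `ν t s`, so goodness applies to
  -- the closure of `s`, with the identity renaming.
  ... | inj₂ (eq , g) | _ = ≡.subst (flip SNCut _) (rename-id _)
    (SNCutˡ q eq (λ d → proj₁ (g ν₂) ⊆-refl d (Env-◁ ν₂ e)) d₂)
  ... | inj₁ _ | inj₂ (eq , g) = ≡.subst (SNCut _) (rename-id _)
    (SNCutʳ q eq (λ d → proj₁ (g ν₁) ⊆-refl d (Env-◁ ν₁ e)) d₁)
  ... | inj₁ i₁ | inj₁ i₂ = SNCut-expansion
    (⇓-subst (rs ν₁) d₁ (Env-◁ ν₁ e))
    (⇓-subst (rs ν₂) d₂ (Env-◁ ν₂ e))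
    (Env-⊩ (acc rs) e d₂)
    λ r → contractum (▷-Image⁻ i₁ i₂ r)
    where
    contractum : ∀ {u v} →
      (∃[ t′ ] ∃[ s′ ] (_ ∣ _ ▷ t′ ∣ s′) × u ≡ subst σ t′ × v ≡ subst σ s′) → SNCut u v
    contractum (_ , _ , r , refl , refl) with _ , d₁′ , d₂′ ← ▷-preserves-⊩ d₁ d₂ r =
      SNCut-subst (rs (reduct (root r))) d₁′ d₂′ (Env-◁ (reduct (root r)) e)

  ⇓-rename-subst : ∀ (x : Acc◁ t) {σ : Substitution m k} → Γ ⊩ t ∶ a → Env x Γ Δ σ →
                   ∀ {l} {ρ : Renaming k l} {Δ′} → Δ ⊆[ ρ ] Δ′ → ⇓ (rename ρ (subst σ t))
  ⇓-rename-subst {t = t} x d e h =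
    ≡.subst ⇓ (sym (rename-subst (λ _ → refl) t)) (⇓-subst x d (Env-rename x h e))

  -- A renaming is an environment consisting of variables only, so `⇓-subst` applies and reducts of
  -- a renamed term need not be analysed.
  ⇓-rename : ∀ {ρ : Renaming m k} → Γ ⊆[ ρ ] Δ → Γ ⊩ t ∶ a → ⇓ t → ⇓ (rename ρ t)
  ⇓-rename {t = t} h d ⇓t =
    ≡.subst ⇓ (sym (rename≡subst (λ _ → refl) t))
      (⇓-subst (⇓⇒Acc◁ ⇓t) d (Env-var (⇓⇒Acc◁ ⇓t) h))

-- Cuts on a fixed type

module _ (A : Type)
  -- This parameter carries the induction hypothesis on the cut type.
  (reducts : ∀ {k} {Δ : Basis k} {t s t′ s′} → ⇓ t → ⇓ s →
             Δ ⊩ t ∶ (+ , A) → Δ ⊩ s ∶ (- , A) → t ∣ s ↦ t′ ∣ s′ → SNCut t′ s′)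
  where

  SNCut-closures :
    ∀ (x : Acc◁ t) (y : Acc◁ s) {σ : Substitution m l} {τ : Substitution k l} →
    Γ ⊩ t ∶ (+ , A) → Γ′ ⊩ s ∶ (- , A) → Env + A x Γ Δ σ → Env - A y Γ′ Δ τ →
    SNCut (subst σ t) (subst τ s)
  -- Unfolding goodness returns to `SNCut-closures` with `x` decreased and `y` kept; `Good-closure⁻`
  -- keeps `x` and decreases `y`. The mutual recursion therefore terminates.
  Good-closure⁺ :
    ∀ {X} (x : Acc _◁_ X) (y : Acc◁ s) {τ : Substitution k l} →
    Γ′ ⊩ s ∶ (- , A) → Env - A y Γ′ Δ τ → Good + A x Δ (subst τ s)
  Good-closure⁻ :
    ∀ (x : Acc◁ t) {Y} (y : Acc _◁_ Y) {σ : Substitution k l} →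
    Γ ⊩ t ∶ (+ , A) → Env + A x Γ Δ σ → Good - A y Δ (subst σ t)

  Good-closure⁺ {s = s} (acc rs) y {τ} d f lt =
    (λ {_ _ ρ} h d′ e →
      ≡.subst (SNCut _) (sym (rename-subst {ρ = ρ} (λ _ → refl) s))
        (SNCut-closures (rs lt) y d′ d e (Env-rename - A y h f))) ,
    Good-closure⁺ (rs lt) y d f

  Good-closure⁻ {t = t} x (acc rs) {σ} d e lt =
    (λ {_ _ ρ} h d′ f →
      ≡.subst (flip SNCut _) (sym (rename-subst {ρ = ρ} (λ _ → refl) t))
        (SNCut-closures x (rs lt) d d′ (Env-rename + A x h e) f)) ,
    Good-closure⁻ x (rs lt) d e

  SNCut-closures {t = t} {s = s} {Δ = Δ} x y {σ} {τ} d d′ e f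
    with image? + A x e d | image? - A y f d′
  -- Both heads are intact: `σ` replaces only variables of sign `-` by non-variables, while `t` has
  -- sign `+`, and dually for `τ` and `s`.
  ... | inj₁ i | inj₁ j = SNCut-expansion ⇓t ⇓s ⊩s (λ r → contracta d d′ i j r refl refl)
    where
    ⇓t = ⇓-subst + A x d e
    ⇓s = ⇓-subst - A y d′ f
    ⊩t = Env-⊩ + A x e d
    ⊩s = Env-⊩ - A y f d′
    contracta : ∀ {u v u′ v′} → _ ⊩ t ∶ (+ , A) → _ ⊩ s ∶ (- , A) →
                Image σ t u → Image τ s v → u ∣ v ▷ u′ ∣ v′ →
                u ≡ subst σ t → v ≡ subst τ s → SNCut u′ v′
    contracta _ _ _ _ (principal r) refl refl = reducts ⇓t ⇓s ⊩t ⊩s r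
    contracta (Cut c₁ c₂) _ (ν {t₁} {t₂}) _ RBetaL _ refl
      rewrite single-liftₛ σ (subst τ s) t₁ | single-liftₛ σ (subst τ s) t₂ =
      SNCut-subst + A x c₁ c₂ λ where
        -- The bound variable has type `(- , A)`, exactly what an environment for `+` admits, so the
        -- opposing closure becomes its entry.
        zero    → ⊩s , inj₂ (refl , ⇓-rename-subst - A y d′ f , Good-closure⁺ x y d′ f)
        (suc z) → e z
    contracta _ (Cut c₁ c₂) _ (ν {s₁} {s₂}) RBetaR refl _
      rewrite single-liftₛ τ (subst σ t) s₁ | single-liftₛ τ (subst σ t) s₂ =
      SNCut-subst - A y c₁ c₂ λ where
        zero    → ⊩t , inj₂ (refl , ⇓-rename-subst + A x d e , Good-closure⁻ x y d e)
        (suc z) → f z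

module _ (A : Type)
  (cuts : ∀ {k} {Δ : Basis k} {t s} → ⇓ t → ⇓ s → Δ ⊩ t ∶ (+ , A) → Δ ⊩ s ∶ (- , A) → SNCut t s)
  where

  oriented-cuts : ∀ q → ⇓ t → ⇓ s → Γ ⊩ t ∶ (q , A) → Γ ⊩ s ∶ (opposite q , A) →
                  OrientedCut q t s
  oriented-cuts + ⇓t ⇓s d e = cuts ⇓t ⇓s d e
  oriented-cuts - ⇓t ⇓s d e = cuts ⇓s ⇓t e d

  module _ (q : Polarity) (⇓s : ⇓ s) (d : Γ ⊩ s ∶ (opposite q , A)) where

    Good-⇓ : ∀ {X} (x : Acc _◁_ X) → Good q A x Γ s
    Good-⇓ (acc rs) lt =
      (λ h d′ e → oriented-cuts q (⇓-subst q A (rs lt) d′ e) (⇓-rename q A h d ⇓s)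
                    (Env-⊩ q A (rs lt) e d′) (⊩-rename h d)) ,
      Good-⇓ (rs lt)

    -- For `RImp` and `RImpBar`: the instantiated body must be strongly normalising before it can be
    -- cut on the codomain. Once all cuts on `A` terminate, every strongly normalising argument is
    -- good.
    ⇓-single : ⇓ t → (opposite q , A) ∷ Γ ⊩ t ∶ a → ⇓ ([ s /0] t)
    ⇓-single ⇓t d′ = ⇓-subst q A (⇓⇒Acc◁ ⇓t) d′ λ where
      zero    → d , inj₂ (refl , (λ h → ⇓-rename q A h d ⇓s) , Good-⇓ (⇓⇒Acc◁ ⇓t))
      (suc y) → Ax refl , inj₁ (y , refl)

-- Strong normalisation

SNCut-⇓ : ∀ A → ⇓ t → ⇓ s → Γ ⊩ t ∶ (+ , A) → Γ ⊩ s ∶ (- , A) → SNCut t s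
SNCut-↦ : ∀ A → ⇓ t → ⇓ s → Γ ⊩ t ∶ (+ , A) → Γ ⊩ s ∶ (- , A) →
          t ∣ s ↦ t′ ∣ s′ → SNCut t′ s′

SNCut-⇓ {t = t} {s = s} A ⇓t ⇓s d e =
  ≡.subst₂ SNCut (subst-var (λ _ → refl) t) (subst-var (λ _ → refl) s)
    (SNCut-closures A (SNCut-↦ A) x y d e (Env-var + A x ⊆-refl) (Env-var - A y ⊆-refl))
  where
  x = ⇓⇒Acc◁ ⇓t
  y = ⇓⇒Acc◁ ⇓s

SNCut-↦ (A ⇒[ _ ] B) ⇓t ⇓s (Imp d) (ImpBar e₁ e₂) RImp =
  -- The argument `e₁` has sign `+`, so the terms it is cut against have sign `-`.
  SNCut-⇓ B (⇓-single A (SNCut-⇓ A) - (⇓-⟪,⟫⁻¹ ⇓s) e₁ (⇓-lam⁻ ⇓t) d) (⇓-⟪,⟫⁻² ⇓s)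
    (⊩-single d e₁) e₂
SNCut-↦ (A ⇒[ _ ] B) ⇓t ⇓s (ImpBar e₁ e₂) (Imp d) RImpBar =
  SNCut-⇓ B (⇓-⟪,⟫⁻² ⇓t) (⇓-single A (SNCut-⇓ A) + (⇓-⟪,⟫⁻¹ ⇓t) e₁ (⇓-lam⁻ ⇓s) d)
    e₂ (⊩-single d e₁)
SNCut-↦ (A ∧[ _ ] B) ⇓t ⇓s (And d₁ d₂) (AndBar {one} e) RAnd =
  SNCut-⇓ A (⇓-pair⁻¹ ⇓t) (⇓-inj⁻ ⇓s) d₁ e
SNCut-↦ (A ∧[ _ ] B) ⇓t ⇓s (And d₁ d₂) (AndBar {two} e) RAnd =
  SNCut-⇓ B (⇓-pair⁻² ⇓t) (⇓-inj⁻ ⇓s) d₂ e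
SNCut-↦ (A ∧[ _ ] B) ⇓t ⇓s (AndBar {one} e) (And d₁ d₂) RAndBar =
  SNCut-⇓ A (⇓-inj⁻ ⇓t) (⇓-pair⁻¹ ⇓s) e d₁
SNCut-↦ (A ∧[ _ ] B) ⇓t ⇓s (AndBar {two} e) (And d₁ d₂) RAndBar =
  SNCut-⇓ B (⇓-inj⁻ ⇓t) (⇓-pair⁻² ⇓s) e d₂

⊩⇒⇓ : Γ ⊩ t ∶ a → ⇓ t
⊩⇒⇓ (Ax _)         = acc λ ()
⊩⇒⇓ Unit           = acc λ ()
⊩⇒⇓ (And d₁ d₂)    = ⇓-pair (⊩⇒⇓ d₁) (⊩⇒⇓ d₂)
⊩⇒⇓ (AndBar d)     = ⇓-inj (⊩⇒⇓ d)
⊩⇒⇓ (Imp d)        = ⇓-lam (⊩⇒⇓ d)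
⊩⇒⇓ (ImpBar d₁ d₂) = ⇓-⟪,⟫ (⊩⇒⇓ d₁) (⊩⇒⇓ d₂)
⊩⇒⇓ (Cut d₁ d₂)    = ⇓-ν (SNCut-⇓ _ (⊩⇒⇓ d₁) (⊩⇒⇓ d₂) d₁ d₂)

Acc⇒SN : Acc (flip _↝_) t → SN t
Acc⇒SN = descent∧acc⇒unsatisfiable
  {P = λ t → ∃[ f ] InfiniteDescendingSequenceFrom (flip _↝_) f t}
  -- The tail of a descending sequence is again one, starting at a reduct.
  λ { (f , refl , r) → f 1 , r 0 , f ∘ suc , refl , r ∘ suc }

corollary6p13 : (m : ℕ) (G : Graph) (Γ : Ctx m) (t : Term m) (p : Polarity) (A : Type) (n : Node) → G ⨾ Γ ⊢ t ∶ p ∙ A at n → SN t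
corollary6p13 m G Γ t p A n d =
  Acc⇒SN (Subrelation.accessible ↝⊆⇝ (⊩⇒⇓ (forget-nodes (λ _ → refl) d)))
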